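{- (Soundness of $QLET_F$.) Let $\mathcal{S}$ be a signature and let $\Gamma\cup\{A\}\subseteq Sent(\mathcal{S})$. If $\Gamma\vdash A$ in $QLET_F$, then $\Gamma\vDash A$.
   Context: **Language.** A signature is a pair $\mathcal{S}=\langle\mathcal{C},\mathcal{P}\rangle$, where $\mathcal{C}$ is an infinite set of individual constants and $\mathcal{P}$ is a set of predicate letters, each of finite arity, containing a binary identity predicate $\approx$. The logical symbols are the unary connectives $\neg,\circ,\bullet$, the binary connectives $\land,\lor$, the quantifiers $\forall,\exists$, and variables $\mathcal{V}=\{v_i:i\in\mathbb{N}\}$. Terms are variables and constants (no function symbols). Formulas are defined as usual, except that void quantifiers are not allowed: $\forall xB$ and $\exists xB$ are formulas only if $x$ is free in $B$. $Form(\mathcal{S})$ and $Sent(\mathcal{S})$ are the sets of formulas and of sentences (closed formulas). $A(t/x)$ is the result of replacing every free occurrence of $x$ in $A$ by $t$. Two formulas are alphabetic variants if they differ only in (some of) their bound variables. **Natural deduction system $QLET_F$** (over sentences of $\mathcal{S}$; $c,c_1,c_2\in\mathcal{C}$; wherever $A(c/x)$ occurs, $A$ is a formula with no free variable other than $x$; square brackets mark discharged hypotheses): - $\land I$: from $A$, $B$ infer $A\land B$. $\land E$: from $A\land B$ infer $A$; from $A\land B$ infer $B$. - $\lor I$: from $A$ infer $A\lor B$; from $B$ infer $A\lor B$. $\lor E$: from $A\lor B$, a derivation of $C$ from $[A]$ and a derivation of $C$ from $[B]$, infer $C$. - $\neg\land I$: from $\neg A$ infer $\neg(A\land B)$; from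 $\neg B$ infer $\neg(A\land B)$. $\neg\land E$: from $\neg(A\land B)$, a derivation of $C$ from $[\neg A]$ and a derivation of $C$ from $[\neg B]$, infer $C$. - $\neg\lor I$: from $\neg A$, $\neg B$ infer $\neg(A\lor B)$. $\neg\lor E$: from $\neg(A\lor B)$ infer $\neg A$; from $\neg(A\lor B)$ infer $\neg B$. - $DN$: from $A$ infer $\neg\neg A$; from $\neg\neg A$ infer $A$. - $EXP^{\circ}$: from $\circ A$, $A$, $\neg A$ infer $B$. $PEM^{\circ}$: from $\circ A$ infer $A\lor\neg A$. - $Cons$: from $\circ A$, $\bullet A$ infer $B$. $Comp$: infer $\circ A\lor\bullet A$ from no premises. - $\forall I$: from $B\lor A(c/x)$ infer $B\lor\forall xA$, provided $c$ occurs neither in $A$ or $B$ nor in any hypothesis on which $B\lor A(c/x)$ depends. $\forall E$: from $\forall xA$ infer $A(c/x)$. - $\exists I$: from $A(c/x)$ infer $\exists xA$. $\exists E$: from $\exists xA$ and a derivation of $C$ from $[A(c/x)]$ infer $C$, provided $c$ occurs neither in $A$ or $C$ nor in any hypothesis on which $C$ depends, except $A(c/x)$. - $\neg\forall I$: from $\neg A(c/x)$ infer $\neg\forall xA$. $\neg\forall E$: from $\neg\forall xA$ and a derivation of $C$ from $[\neg A(c/x)]$ infer $C$, provided $c$ occurs neither in $A$ or $C$ nor in any hypothesis on which $C$ depends, except $\neg A(c/x)$. - $\neg\exists I$: from $\neg A(c/x)$ infer $\neg\exists xA$, provided $c$ occurs neither in $A$ nor in any hypothesis on which $\neg A(c/x)$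 depends. $\neg\exists E$: from $\neg\exists xA$ infer $\neg A(c/x)$. - $\approx I$: infer $c\approx c$ from no premises. $\approx E$: from $c_1\approx c_2$ and $A(c_1/x)$ infer $A(c_2/x)$. - $AV$: from $A$ infer $A'$, for any alphabetic variant $A'$ of $A$. $\Gamma\vdash A$ (or $\Gamma\vdash_{\mathcal S}A$) means there is a (finite, tree-shaped) derivation of $A$ all of whose undischarged hypotheses belong to $\Gamma$. **Semantics.** An $\mathcal{S}$-structure is a pair $\mathfrak{A}=\langle\mathcal{D},\mathcal{I}\rangle$ with $\mathcal{D}\neq\emptyset$ such that $\mathcal{I}(c)=c^{\mathfrak{A}}\in\mathcal{D}$ for each $c\in\mathcal{C}$; each $n$-ary $P\in\mathcal{P}$ is assigned a pair $\langle P_+^{\mathfrak{A}},P_-^{\mathfrak{A}}\rangle$ with $P_+^{\mathfrak{A}}\cup P_-^{\mathfrak{A}}\subseteq\mathcal{D}^n$; and $\approx_+^{\mathfrak{A}}=\{\langle a,a\rangle:a\in\mathcal{D}\}$ (no constraint on $\approx_-^{\mathfrak A}$). The diagram signature $\mathcal{S}_{\mathfrak{A}}=\langle\mathcal{C}_{\mathfrak{A}},\mathcal{P}\rangle$ adds a new constant $\overline{a}$ for each $a\in\mathcal{D}$, i.e. $\mathcal{C}_{\mathfrak{A}}=\mathcal{C}\cup\{\overline{a}:a\in\mathcal{D}\}$; $\widehat{\mathfrak{A}}$ is the $\mathcal{S}_{\mathfrak{A}}$-structure that is just like $\mathfrak{A}$ except that $\overline{a}^{\widehat{\mathfrak{A}}}=a$.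 A map $v:Sent(\mathcal{S}_{\mathfrak{A}})\to\{0,1\}$ is an $\mathfrak{A}$-valuation if: 1. $v(P(c_1,\dots,c_n))=1$ iff $\langle c_1^{\widehat{\mathfrak{A}}},\dots,c_n^{\widehat{\mathfrak{A}}}\rangle\in P_+^{\mathfrak{A}}$; 2. $v(\neg P(c_1,\dots,c_n))=1$ iff $\langle c_1^{\widehat{\mathfrak{A}}},\dots,c_n^{\widehat{\mathfrak{A}}}\rangle\in P_-^{\mathfrak{A}}$ (in 1 and 2, for all $c_1,\dots,c_n\in\mathcal{C}_{\mathfrak{A}}$); 3. $v(A\land B)=1$ iff $v(A)=1$ and $v(B)=1$; 4. $v(A\lor B)=1$ iff $v(A)=1$ or $v(B)=1$; 5. $v(\neg(A\land B))=1$ iff $v(\neg A)=1$ or $v(\neg B)=1$; 6. $v(\neg(A\lor B))=1$ iff $v(\neg A)=1$ and $v(\neg B)=1$; 7. $v(\neg\neg A)=1$ iff $v(A)=1$; 8. if $v(\circ A)=1$, then ($v(A)=1$ iff $v(\neg A)=0$); 9. $v(\circ A)=1$ iff $v(\bullet A)=0$; 10. $v(\forall xA)=1$ iff $v(A(\overline{a}/x))=1$ for every $a\in\mathcal{D}$; 11. $v(\exists xA)=1$ iff $v(A(\overline{a}/x))=1$ for some $a\in\mathcal{D}$; 12. $v(\neg\forall xA)=1$ iff $v(\neg A(\overline{a}/x))=1$ for some $a\in\mathcal{D}$; 13. $v(\neg\exists xA)=1$ iff $v(\neg A(\overline{a}/x))=1$ for every $a\in\mathcal{D}$; 14. if $A'$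 is an alphabetic variant of $A$, then $v(A')=v(A)$; 15. if $A\in Form(\mathcal{S}_{\mathfrak{A}})$ has no free variable other than $x$, $c_1,c_2\in\mathcal{C}_{\mathfrak{A}}$, $c_1^{\widehat{\mathfrak{A}}}=c_2^{\widehat{\mathfrak{A}}}$ and $v(A(c_1/x))=v(A(c_2/x))$, then $v(\#A(c_1/x))=v(\#A(c_2/x))$ for each $\#\in\{\neg,\circ,\bullet\}$. An $\mathcal{S}$-interpretation is a pair $\langle\mathfrak{A},v\rangle$ with $\mathfrak{A}$ an $\mathcal{S}$-structure and $v$ an $\mathfrak{A}$-valuation. $\mathfrak{A},v\vDash A$ means $v(A)=1$; $\mathfrak{A},v\vDash\Gamma$ means $v(B)=1$ for every $B\in\Gamma$. $\Gamma\vDash A$ means: for every $\mathcal{S}$-interpretation, $\mathfrak{A},v\vDash\Gamma$ implies $\mathfrak{A},v\vDash A$. -}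

module Defs where

open import Data.Bool using (Bool; true; false)
open import Data.Empty using (⊥)
open import Data.List using (List; []; _∷_)
open import Data.Nat using (ℕ; _≟_)
open import Data.Product using (Σ-syntax; ∃-syntax; _×_; _,_; proj₁; proj₂)
open import Data.Sum using (_⊎_; inj₁; inj₂; [_,_])
open import Data.Sum.Properties using (inj₁-injective)
open import Data.Vec as Vec using (Vec; []; _∷_)
open import Data.Vec.Relation.Binary.Pointwise.Inductive using (Pointwise)
open import Data.Vec.Relation.Unary.Any using (Any; here; there)
open import Function using (_∘_; id; _↣_; _⇔_; mk↣)
open import Function.Construct.Composition using (_↣-∘_)
open import Level using (0ℓ)
open import Relation.Binary.PropositionalEquality using (_≡_; _≢_; refl; sym; trans)
open import Relation.Nullary using (¬_; yes; no; contradiction)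
open import Relation.Unary using (Pred; _∈_; _⊆_; _∪_; _∖_; ｛_｝; ∅)

infix  30 _[_/_] _⟨_⟩
infixr 25 _∧ˢ_ _∨ˢ_
infix  26 ¬ˢ_ ∘ˢ_ •ˢ_
infix  4  _∼_ _▷_ _⊢_ _⊨_ _⊩_ _⊩*_

------------------------------------------------------------------------
-- Language

record Signature : Set₁ where
  field
    Constant  : Set
    infinite  : ℕ ↣ Constant
    Predicate : ℕ → Set          -- indexed by arity
    identity  : Predicate 2

open Signature public

data Term (S : Signature) : Set where
  var : ℕ → Term S
  cst : Constant S → Term S

data Unary : Set where
  neg circ bullet : Unary        -- ¬, ∘, •

data Binary : Set where
  conj disj : Binary

data Quantifier : Set where
  univ exis : Quantifier

FreeT : ∀ {S} → ℕ → Term S → Set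
FreeT x (var y) = x ≡ y
FreeT x (cst c) = ⊥

-- Void quantifiers are excluded, so formulas are defined simultaneously
-- with the relation "x is free in A".  The proof of non-voidness is
-- irrelevant and does not affect the identity of formulas.

data Form (S : Signature) : Set
Free : ∀ {S} → ℕ → Form S → Set

data Form S where
  atom  : ∀ {n} → Predicate S n → Vec (Term S) n → Form S
  un    : Unary → Form S → Form S
  bin   : Binary → Form S → Form S → Form S
  quant : Quantifier → (x : ℕ) (A : Form S) → .(Free x A) → Form S

Free x (atom P ts)     = Any (FreeT x) ts
Free x (un u A)        = Free x A
Free x (bin b A B)     = Free x A ⊎ Free x B
Free x (quant Q y A _) = x ≢ y × Free x A

OccursT : ∀ {S} → Constant S → Term S → Set
OccursT c (var y) = ⊥
OccursT c (cst d) = c ≡ d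

Occurs : ∀ {S} → Constant S → Form S → Set
Occurs c (atom P ts)     = Any (OccursT c) ts
Occurs c (un u A)        = Occurs c A
Occurs c (bin b A B)     = Occurs c A ⊎ Occurs c B
Occurs c (quant Q y A _) = Occurs c A

------------------------------------------------------------------------
-- Substitution for the free occurrences of a variable

substT : ∀ {S} → Term S → ℕ → Term S → Term S
substT t x (cst c) = cst c
substT t x (var y) with x ≟ y
... | yes _ = t
... | no  _ = var y

freeT-subst : ∀ {S} {y x} {t : Term S} (s : Term S) → y ≢ x →
              FreeT y s → FreeT y (substT t x s)
freeT-subst {x = x} (var z) y≢x y≡z with x ≟ z
... | yes x≡z = contradiction (trans y≡z (sym x≡z)) y≢x
... | no  _   = y≡z

freeV-subst : ∀ {S n} {y x} {t : Term S} (ss : Vec (Term S) n) → y ≢ x →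
              Any (FreeT y) ss → Any (FreeT y) (Vec.map (substT t x) ss)
freeV-subst (s ∷ ss) y≢x (here p)  = here (freeT-subst s y≢x p)
freeV-subst (s ∷ ss) y≢x (there p) = there (freeV-subst ss y≢x p)

-- A [ t / x ] is literal replacement (no renaming of bound variables);
-- below, only constants are ever substituted, so capture cannot arise.

_[_/_] : ∀ {S} → Form S → Term S → ℕ → Form S
free-subst : ∀ {S} {y x} {t : Term S} (A : Form S) → y ≢ x →
             Free y A → Free y (A [ t / x ])

atom P ts     [ t / x ] = atom P (Vec.map (substT t x) ts)
un u A        [ t / x ] = un u (A [ t / x ])
bin b A B     [ t / x ] = bin b (A [ t / x ]) (B [ t / x ])
quant Q y A p [ t / x ] with x ≟ y
... | yes _   = quant Q y A p
... | no  x≢y = quant Q y (A [ t / x ]) (free-subst A (x≢y ∘ sym) p)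

free-subst (atom P ts)  y≢x p        = freeV-subst ts y≢x p
free-subst (un u A)     y≢x p        = free-subst A y≢x p
free-subst (bin b A B)  y≢x (inj₁ p) = inj₁ (free-subst A y≢x p)
free-subst (bin b A B)  y≢x (inj₂ p) = inj₂ (free-subst B y≢x p)
free-subst {x = x} (quant Q z A _) y≢x (y≢z , p) with x ≟ z
... | yes _ = y≢z , p
... | no  _ = y≢z , free-subst A y≢x p

freeT-subst⁻¹ : ∀ {S} {y x} {c : Constant S} (s : Term S) →
                FreeT y (substT (cst c) x s) → y ≢ x × FreeT y s
freeT-subst⁻¹ {x = x} (var z) p with x ≟ z
freeT-subst⁻¹ (var z) () | yes _
freeT-subst⁻¹ (var z) p  | no x≢z = (λ y≡x → x≢z (trans (sym y≡x) p)) , p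

freeV-subst⁻¹ : ∀ {S n} {y x} {c : Constant S} (ss : Vec (Term S) n) →
                Any (FreeT y) (Vec.map (substT (cst c) x) ss) →
                y ≢ x × Any (FreeT y) ss
freeV-subst⁻¹ (s ∷ ss) (here p) with freeT-subst⁻¹ s p
... | y≢x , q = y≢x , here q
freeV-subst⁻¹ (s ∷ ss) (there p) with freeV-subst⁻¹ ss p
... | y≢x , q = y≢x , there q

free-subst⁻¹ : ∀ {S} {y x} {c : Constant S} (A : Form S) →
               Free y (A [ cst c / x ]) → y ≢ x × Free y A
free-subst⁻¹ (atom P ts) p = freeV-subst⁻¹ ts p
free-subst⁻¹ (un u A)    p = free-subst⁻¹ A p
free-subst⁻¹ (bin b A B) (inj₁ p) with free-subst⁻¹ A p
... | y≢x , q = y≢x , inj₁ q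
free-subst⁻¹ (bin b A B) (inj₂ p) with free-subst⁻¹ B p
... | y≢x , q = y≢x , inj₂ q
free-subst⁻¹ {x = x} (quant Q z A _) p with x ≟ z
free-subst⁻¹ (quant Q z A _) (y≢z , p) | yes x≡z =
  (λ y≡x → y≢z (trans y≡x x≡z)) , (y≢z , p)
free-subst⁻¹ (quant Q z A _) (y≢z , p) | no _ with free-subst⁻¹ A p
... | y≢x , q = y≢x , (y≢z , q)

------------------------------------------------------------------------
-- Sentences

-- Both kinds of proof field below are negations, hence definitionally
-- irrelevant: sentences with the same underlying formula are equal.

record Sent (S : Signature) : Set where
  constructor mkSent
  field
    form   : Form S
    closed : ∀ y → ¬ Free y form

open Sent public

-- Formulas with no free variable other than x.

record Form₁ (S : Signature) (x : ℕ) : Set where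
  constructor mkForm₁
  field
    form₁ : Form S
    only  : ∀ y → y ≢ x → ¬ Free y form₁

open Form₁ public

unˢ : ∀ {S} → Unary → Sent S → Sent S
unˢ u A = mkSent (un u (form A)) (closed A)

binˢ : ∀ {S} → Binary → Sent S → Sent S → Sent S
binˢ b A B = mkSent (bin b (form A) (form B)) (λ y → [ closed A y , closed B y ])

quantˢ : ∀ {S x} → Quantifier → (A : Form₁ S x) → .(Free x (form₁ A)) → Sent S
quantˢ {x = x} Q A p = mkSent (quant Q x (form₁ A) p) (λ y (y≢x , q) → only A y y≢x q)

closedV : ∀ {S n} y (cs : Vec (Constant S) n) → ¬ Any (FreeT {S} y) (Vec.map cst cs)
closedV y (c ∷ cs) (there p) = closedV y cs p

atomˢ : ∀ {S n} → Predicate S n → Vec (Constant S) n → Sent S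
atomˢ P cs = mkSent (atom P (Vec.map cst cs)) (λ y → closedV y cs)

¬ˢ_ ∘ˢ_ •ˢ_ : ∀ {S} → Sent S → Sent S
¬ˢ_ = unˢ neg
∘ˢ_ = unˢ circ
•ˢ_ = unˢ bullet

_∧ˢ_ _∨ˢ_ : ∀ {S} → Sent S → Sent S → Sent S
_∧ˢ_ = binˢ conj
_∨ˢ_ = binˢ disj

∀ˢ ∃ˢ : ∀ {S x} (A : Form₁ S x) → .(Free x (form₁ A)) → Sent S
∀ˢ = quantˢ univ
∃ˢ = quantˢ exis

_≈ˢ_ : ∀ {S} → Constant S → Constant S → Sent S
_≈ˢ_ {S} c d = atomˢ (identity S) (c ∷ d ∷ [])

-- A ⟨ c ⟩ is the sentence A(c/x).

_⟨_⟩ : ∀ {S x} → Form₁ S x → Constant S → Sent S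
_⟨_⟩ {x = x} A c = mkSent (form₁ A [ cst c / x ])
  (λ y p → let (y≢x , q) = free-subst⁻¹ (form₁ A) p in only A y y≢x q)

_∉ᶜ_ : ∀ {S} → Constant S → Form S → Set
c ∉ᶜ A = ¬ Occurs c A

------------------------------------------------------------------------
-- Alphabetic variants

-- In  MatchV ρ x y  and  Variant ρ A B,  the list ρ pairs the variables
-- bound by the enclosing quantifiers on the two sides, innermost first.

MatchV : List (ℕ × ℕ) → ℕ → ℕ → Set
MatchV []             x y = x ≡ y
MatchV ((a , b) ∷ ρ) x y = (x ≡ a × y ≡ b) ⊎ (x ≢ a × y ≢ b × MatchV ρ x y)

data MatchT {S : Signature} (ρ : List (ℕ × ℕ)) : Term S → Term S → Set where
  var : ∀ {x y} → MatchV ρ x y → MatchT ρ (var x) (var y)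
  cst : ∀ {c} → MatchT ρ (cst c) (cst c)

data Variant {S : Signature} (ρ : List (ℕ × ℕ)) : Form S → Form S → Set where
  atom  : ∀ {n} {P : Predicate S n} {ts us} → Pointwise (MatchT ρ) ts us →
          Variant ρ (atom P ts) (atom P us)
  un    : ∀ {u A A′} → Variant ρ A A′ → Variant ρ (un u A) (un u A′)
  bin   : ∀ {b A A′ B B′} → Variant ρ A A′ → Variant ρ B B′ →
          Variant ρ (bin b A B) (bin b A′ B′)
  quant : ∀ {Q x y A A′} .{p : Free x A} .{q : Free y A′} →
          Variant ((x , y) ∷ ρ) A A′ →
          Variant ρ (quant Q x A p) (quant Q y A′ q)

_∼_ : ∀ {S} → Sent S → Sent S → Set
A ∼ B = Variant [] (form A) (form B)

------------------------------------------------------------------------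
-- Natural deduction

_freshFor_ : ∀ {S} → Constant S → Pred (Sent S) 0ℓ → Set
c freshFor H = ∀ B → B ∈ H → c ∉ᶜ form B

-- H ▷ A is the type of derivations of A whose set of undischarged
-- hypotheses is exactly H.  Discharging a hypothesis removes all its
-- occurrences in the subderivation; there may be none (vacuous discharge).

data _▷_ {S : Signature} : Pred (Sent S) 0ℓ → Sent S → Set₁ where

  hyp  : ∀ A → ｛ A ｝ ▷ A

  ∧I   : ∀ {H₁ H₂ A B} → H₁ ▷ A → H₂ ▷ B → (H₁ ∪ H₂) ▷ (A ∧ˢ B)
  ∧E₁  : ∀ {H A B} → H ▷ (A ∧ˢ B) → H ▷ A
  ∧E₂  : ∀ {H A B} → H ▷ (A ∧ˢ B) → H ▷ B

  ∨I₁  : ∀ {H A B} → H ▷ A → H ▷ (A ∨ˢ B)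
  ∨I₂  : ∀ {H A B} → H ▷ B → H ▷ (A ∨ˢ B)
  ∨E   : ∀ {H₁ H₂ H₃ A B C} → H₁ ▷ (A ∨ˢ B) → H₂ ▷ C → H₃ ▷ C →
         (H₁ ∪ (H₂ ∖ ｛ A ｝) ∪ (H₃ ∖ ｛ B ｝)) ▷ C

  ¬∧I₁ : ∀ {H A B} → H ▷ (¬ˢ A) → H ▷ (¬ˢ (A ∧ˢ B))
  ¬∧I₂ : ∀ {H A B} → H ▷ (¬ˢ B) → H ▷ (¬ˢ (A ∧ˢ B))
  ¬∧E  : ∀ {H₁ H₂ H₃ A B C} → H₁ ▷ (¬ˢ (A ∧ˢ B)) → H₂ ▷ C → H₃ ▷ C →
         (H₁ ∪ (H₂ ∖ ｛ ¬ˢ A ｝) ∪ (H₃ ∖ ｛ ¬ˢ B ｝)) ▷ C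

  ¬∨I  : ∀ {H₁ H₂ A B} → H₁ ▷ (¬ˢ A) → H₂ ▷ (¬ˢ B) → (H₁ ∪ H₂) ▷ (¬ˢ (A ∨ˢ B))
  ¬∨E₁ : ∀ {H A B} → H ▷ (¬ˢ (A ∨ˢ B)) → H ▷ (¬ˢ A)
  ¬∨E₂ : ∀ {H A B} → H ▷ (¬ˢ (A ∨ˢ B)) → H ▷ (¬ˢ B)

  DNI  : ∀ {H A} → H ▷ A → H ▷ (¬ˢ ¬ˢ A)
  DNE  : ∀ {H A} → H ▷ (¬ˢ ¬ˢ A) → H ▷ A

  EXP∘ : ∀ {H₁ H₂ H₃ A B} → H₁ ▷ (∘ˢ A) → H₂ ▷ A → H₃ ▷ (¬ˢ A) →
         (H₁ ∪ H₂ ∪ H₃) ▷ B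
  PEM∘ : ∀ {H A} → H ▷ (∘ˢ A) → H ▷ (A ∨ˢ (¬ˢ A))

  Cons : ∀ {H₁ H₂ A B} → H₁ ▷ (∘ˢ A) → H₂ ▷ (•ˢ A) → (H₁ ∪ H₂) ▷ B
  Comp : ∀ {A} → ∅ ▷ ((∘ˢ A) ∨ˢ (•ˢ A))

  ∀I   : ∀ {H B x c} {A : Form₁ S x} .{p : Free x (form₁ A)} →
         c ∉ᶜ form₁ A → c ∉ᶜ form B → c freshFor H →
         H ▷ (B ∨ˢ (A ⟨ c ⟩)) → H ▷ (B ∨ˢ ∀ˢ A p)
  ∀E   : ∀ {H x c} {A : Form₁ S x} .{p : Free x (form₁ A)} →
         H ▷ ∀ˢ A p → H ▷ (A ⟨ c ⟩)

  ∃I   : ∀ {H x c} {A : Form₁ S x} .{p : Free x (form₁ A)} →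
         H ▷ (A ⟨ c ⟩) → H ▷ ∃ˢ A p
  ∃E   : ∀ {H₁ H₂ C x c} {A : Form₁ S x} .{p : Free x (form₁ A)} →
         c ∉ᶜ form₁ A → c ∉ᶜ form C → c freshFor (H₂ ∖ ｛ A ⟨ c ⟩ ｝) →
         H₁ ▷ ∃ˢ A p → H₂ ▷ C → (H₁ ∪ (H₂ ∖ ｛ A ⟨ c ⟩ ｝)) ▷ C

  ¬∀I  : ∀ {H x c} {A : Form₁ S x} .{p : Free x (form₁ A)} →
         H ▷ (¬ˢ (A ⟨ c ⟩)) → H ▷ (¬ˢ ∀ˢ A p)
  ¬∀E  : ∀ {H₁ H₂ C x c} {A : Form₁ S x} .{p : Free x (form₁ A)} →
         c ∉ᶜ form₁ A → c ∉ᶜ form C → c freshFor (H₂ ∖ ｛ ¬ˢ (A ⟨ c ⟩) ｝) →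
         H₁ ▷ (¬ˢ ∀ˢ A p) → H₂ ▷ C → (H₁ ∪ (H₂ ∖ ｛ ¬ˢ (A ⟨ c ⟩) ｝)) ▷ C

  ¬∃I  : ∀ {H x c} {A : Form₁ S x} .{p : Free x (form₁ A)} →
         c ∉ᶜ form₁ A → c freshFor H →
         H ▷ (¬ˢ (A ⟨ c ⟩)) → H ▷ (¬ˢ ∃ˢ A p)
  ¬∃E  : ∀ {H x c} {A : Form₁ S x} .{p : Free x (form₁ A)} →
         H ▷ (¬ˢ ∃ˢ A p) → H ▷ (¬ˢ (A ⟨ c ⟩))

  ≈I   : ∀ {c} → ∅ ▷ (c ≈ˢ c)
  ≈E   : ∀ {H₁ H₂ x c₁ c₂} {A : Form₁ S x} →
         H₁ ▷ (c₁ ≈ˢ c₂) → H₂ ▷ (A ⟨ c₁ ⟩) → (H₁ ∪ H₂) ▷ (A ⟨ c₂ ⟩)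

  AV   : ∀ {H A A′} → A ∼ A′ → H ▷ A → H ▷ A′

_⊢_ : ∀ {S} → Pred (Sent S) 0ℓ → Sent S → Set₁
_⊢_ {S} Γ A = Σ[ H ∈ Pred (Sent S) 0ℓ ] H ⊆ Γ × H ▷ A

------------------------------------------------------------------------
-- Structures and their diagram signatures

record Structure (S : Signature) : Set₁ where
  field
    Domain     : Set
    inhabitant : Domain
    ⟦_⟧ᶜ       : Constant S → Domain
    _⁺ _⁻      : ∀ {n} → Predicate S n → Pred (Vec Domain n) 0ℓ
    identity⁺  : ∀ a b → (a ∷ b ∷ []) ∈ (identity S ⁺) ⇔ a ≡ b

diagram : ∀ {S} → Structure S → Signature
diagram {S} 𝔄 = record
  { Constant  = Constant S ⊎ Structure.Domain 𝔄
  ; infinite  = mk↣ inj₁-injective ↣-∘ infinite S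
  ; Predicate = Predicate S
  ; identity  = identity S
  }

expansion : ∀ {S} (𝔄 : Structure S) → Structure (diagram 𝔄)
expansion 𝔄 = record
  { Domain     = Domain
  ; inhabitant = inhabitant
  ; ⟦_⟧ᶜ       = [ ⟦_⟧ᶜ , id ]
  ; _⁺         = _⁺
  ; _⁻         = _⁻
  ; identity⁺  = identity⁺
  } where open Structure 𝔄

-- Sentences of S as sentences of the diagram signature.

module _ {S : Signature} (𝔄 : Structure S) where

  embedT : Term S → Term (diagram 𝔄)
  embedT (var x) = var x
  embedT (cst c) = cst (inj₁ c)

  freeV-embed : ∀ {n y} (ts : Vec (Term S) n) →
                Any (FreeT y) ts → Any (FreeT y) (Vec.map embedT ts)
  freeV-embed (var x ∷ ts) (here p)  = here p
  freeV-embed (t     ∷ ts) (there p) = there (freeV-embed ts p)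

  freeV-embed⁻¹ : ∀ {n y} (ts : Vec (Term S) n) →
                  Any (FreeT y) (Vec.map embedT ts) → Any (FreeT y) ts
  freeV-embed⁻¹ (var x ∷ ts) (here p)  = here p
  freeV-embed⁻¹ (t     ∷ ts) (there p) = there (freeV-embed⁻¹ ts p)

  embedF : Form S → Form (diagram 𝔄)
  free-embed : ∀ {y} (A : Form S) → Free y A → Free y (embedF A)

  embedF (atom P ts)     = atom P (Vec.map embedT ts)
  embedF (un u A)        = un u (embedF A)
  embedF (bin b A B)     = bin b (embedF A) (embedF B)
  embedF (quant Q x A p) = quant Q x (embedF A) (free-embed A p)

  free-embed (atom P ts)     p         = freeV-embed ts p
  free-embed (un u A)        p         = free-embed A p
  free-embed (bin b A B)     (inj₁ p)  = inj₁ (free-embed A p)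
  free-embed (bin b A B)     (inj₂ p)  = inj₂ (free-embed B p)
  free-embed (quant Q x A _) (y≢x , p) = y≢x , free-embed A p

  free-embed⁻¹ : ∀ {y} (A : Form S) → Free y (embedF A) → Free y A
  free-embed⁻¹ (atom P ts)     p         = freeV-embed⁻¹ ts p
  free-embed⁻¹ (un u A)        p         = free-embed⁻¹ A p
  free-embed⁻¹ (bin b A B)     (inj₁ p)  = inj₁ (free-embed⁻¹ A p)
  free-embed⁻¹ (bin b A B)     (inj₂ p)  = inj₂ (free-embed⁻¹ B p)
  free-embed⁻¹ (quant Q x A _) (y≢x , p) = y≢x , free-embed⁻¹ A p

  embed : Sent S → Sent (diagram 𝔄)
  embed A = mkSent (embedF (form A)) (λ y p → closed A y (free-embed⁻¹ (form A) p))

------------------------------------------------------------------------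
-- Valuations and consequence

record IsValuation {S : Signature} (𝔄 : Structure S)
                   (v : Sent (diagram 𝔄) → Bool) : Set where

  open Structure 𝔄 using (Domain; _⁺; _⁻)
  open Structure (expansion 𝔄) using (⟦_⟧ᶜ)

  True : Sent (diagram 𝔄) → Set
  True A = v A ≡ true

  False : Sent (diagram 𝔄) → Set
  False A = v A ≡ false

  name : Domain → Constant (diagram 𝔄)
  name = inj₂

  field
    v-atom  : ∀ {n} (P : Predicate S n) (cs : Vec (Constant (diagram 𝔄)) n) →
              True (atomˢ P cs) ⇔ (Vec.map ⟦_⟧ᶜ cs ∈ (P ⁺))
    v-¬atom : ∀ {n} (P : Predicate S n) (cs : Vec (Constant (diagram 𝔄)) n) →
              True (¬ˢ atomˢ P cs) ⇔ (Vec.map ⟦_⟧ᶜ cs ∈ (P ⁻))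
    v-∧     : ∀ A B → True (A ∧ˢ B) ⇔ (True A × True B)
    v-∨     : ∀ A B → True (A ∨ˢ B) ⇔ (True A ⊎ True B)
    v-¬∧    : ∀ A B → True (¬ˢ (A ∧ˢ B)) ⇔ (True (¬ˢ A) ⊎ True (¬ˢ B))
    v-¬∨    : ∀ A B → True (¬ˢ (A ∨ˢ B)) ⇔ (True (¬ˢ A) × True (¬ˢ B))
    v-¬¬    : ∀ A → True (¬ˢ ¬ˢ A) ⇔ True A
    v-∘     : ∀ A → True (∘ˢ A) → (True A ⇔ False (¬ˢ A))
    v-•     : ∀ A → True (∘ˢ A) ⇔ False (•ˢ A)
    v-∀     : ∀ {x} (A : Form₁ (diagram 𝔄) x) .(p : Free x (form₁ A)) →
              True (∀ˢ A p) ⇔ (∀ a → True (A ⟨ name a ⟩))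
    v-∃     : ∀ {x} (A : Form₁ (diagram 𝔄) x) .(p : Free x (form₁ A)) →
              True (∃ˢ A p) ⇔ (∃[ a ] True (A ⟨ name a ⟩))
    v-¬∀    : ∀ {x} (A : Form₁ (diagram 𝔄) x) .(p : Free x (form₁ A)) →
              True (¬ˢ ∀ˢ A p) ⇔ (∃[ a ] True (¬ˢ (A ⟨ name a ⟩)))
    v-¬∃    : ∀ {x} (A : Form₁ (diagram 𝔄) x) .(p : Free x (form₁ A)) →
              True (¬ˢ ∃ˢ A p) ⇔ (∀ a → True (¬ˢ (A ⟨ name a ⟩)))
    v-∼     : ∀ A A′ → A ∼ A′ → v A′ ≡ v A
    v-subst : ∀ {x} (A : Form₁ (diagram 𝔄) x) c₁ c₂ → ⟦ c₁ ⟧ᶜ ≡ ⟦ c₂ ⟧ᶜ →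
              v (A ⟨ c₁ ⟩) ≡ v (A ⟨ c₂ ⟩) →
              ∀ u → v (unˢ u (A ⟨ c₁ ⟩)) ≡ v (unˢ u (A ⟨ c₂ ⟩))

record Interpretation (S : Signature) : Set₁ where
  field
    structure   : Structure S
    valuation   : Sent (diagram structure) → Bool
    isValuation : IsValuation structure valuation

open Interpretation public

_⊩_ : ∀ {S} → Interpretation S → Sent S → Set
M ⊩ A = valuation M (embed (structure M) A) ≡ true

_⊩*_ : ∀ {S} → Interpretation S → Pred (Sent S) 0ℓ → Set
M ⊩* Γ = ∀ B → B ∈ Γ → M ⊩ B

_⊨_ : ∀ {S} → Pred (Sent S) 0ℓ → Sent S → Set₁
_⊨_ {S} Γ A = (M : Interpretation S) → M ⊩* Γ → M ⊩ A

module Submission where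

-- Constants have no decidable equality, so the eigenconstant of a quantifier
-- rule cannot be reinterpreted by a function.  Soundness is therefore proved
-- for every functional, ¬¬-total relation from the constants of S to those
-- of the diagram: a relation can be updated at one constant without deciding
-- equality.  Totality and the discharging of hypotheses are only available up
-- to ¬¬, which suffices because truth under a Boolean valuation is ¬¬-stable.

open import Defs
open import Data.Bool using (Bool; true; false)
open import Data.Bool.Properties using (⇔→≡) renaming (_≟_ to _≟ᵇ_)
open import Data.Empty using (⊥-elim)
open import Data.Nat using (ℕ; _≟_)
open import Data.Product using (∃-syntax; _×_; _,_; proj₁; proj₂)
open import Data.Sum as Sum using (_⊎_; inj₁; inj₂; [_,_]′; fromInj₂)
open import Data.Vec as Vec using (Vec; []; _∷_)
open import Data.Vec.Relation.Binary.Pointwise.Inductive using (Pointwise; []; _∷_)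
open import Data.Vec.Relation.Unary.Any using (Any; here; there)
open import Function using (mk⇔; _∘_; case_of_)
open import Function.Bundles using (module Equivalence)
open import Level using (0ℓ)
open import Relation.Binary.PropositionalEquality
  using (_≡_; _≢_; refl; sym; trans; cong; cong₂; subst)
open import Relation.Nullary using (¬_; yes; no; contradiction)
open import Relation.Nullary.Decidable using (decidable-stable; ¬¬-excluded-middle)
open import Relation.Unary using (Pred; _∈_; _∖_; ｛_｝)

open Equivalence using (to; from)

-- Substitutions of constants and recursion over instances

sent-≡ : ∀ {S} {A B : Sent S} → form A ≡ form B → A ≡ B
sent-≡ refl = refl

module _ {S : Signature} where

  -- Substitution into a quantified formula is blocked on the test `x ≟ y`. This lemma and
  -- `subst-under` give its two outcomes as equations, so that an argument can use them without
  -- abstracting the test.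
  subst-bound : ∀ {Q x y A} .{p : Free y A} {t : Term S} → x ≡ y →
                quant Q y A p [ t / x ] ≡ quant Q y A p
  subst-bound {x = x} {y} x≡y with x ≟ y
  ... | yes _  = refl
  ... | no x≢y = contradiction x≡y x≢y

  subst-under : ∀ {Q x y A} .{p : Free y A} {t : Term S} (x≢y : x ≢ y) →
                quant Q y A p [ t / x ] ≡
                quant Q y (A [ t / x ]) (free-subst A (x≢y ∘ sym) p)
  subst-under {x = x} {y} x≢y with x ≟ y
  ... | yes x≡y = contradiction x≡y x≢y
  ... | no _    = refl

  quant-cong : ∀ {Q y} {A B : Form S} .{p : Free y A} .{q : Free y B} →
               A ≡ B → quant Q y A p ≡ quant Q y B q
  quant-cong refl = refl

  substT-comm : ∀ {x y} {c d : Constant S} → x ≢ y → ∀ t →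
                substT {S} (cst d) y (substT (cst c) x t) ≡
                substT (cst c) x (substT (cst d) y t)
  substT-comm x≢y (cst e) = refl
  substT-comm {x} {y} x≢y (var z) with x ≟ z in ex | y ≟ z in ey
  ... | yes x≡z | yes y≡z = contradiction (trans x≡z (sym y≡z)) x≢y
  ... | yes _   | no _    rewrite ex = refl
  ... | no _    | yes _   rewrite ey = refl
  ... | no _    | no _    rewrite ex | ey = refl

  substV-comm : ∀ {x y n} {c d : Constant S} → x ≢ y → (ts : Vec (Term S) n) →
                Vec.map (substT (cst d) y) (Vec.map (substT (cst c) x) ts) ≡
                Vec.map (substT (cst c) x) (Vec.map (substT (cst d) y) ts)
  substV-comm x≢y []       = refl
  substV-comm x≢y (t ∷ ts) = cong₂ _∷_ (substT-comm x≢y t) (substV-comm x≢y ts)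

  -- Constants contain no variables, so neither substitution creates an occurrence for the other to
  -- replace.
  subst-comm : ∀ {x y} {c d : Constant S} → x ≢ y → ∀ A →
               A [ cst c / x ] [ cst d / y ] ≡ A [ cst d / y ] [ cst c / x ]
  subst-comm x≢y (atom P ts) = cong (atom P) (substV-comm x≢y ts)
  subst-comm x≢y (un u A)    = cong (un u) (subst-comm x≢y A)
  subst-comm x≢y (bin b A B) = cong₂ (bin b) (subst-comm x≢y A) (subst-comm x≢y B)
  subst-comm {x} {y} {c} {d} x≢y (quant Q z A p) with x ≟ z in ex | y ≟ z in ey
  ... | yes _ | yes _ rewrite ex | ey = refl
  ... | yes _ | no _  rewrite ex | ey = refl
  ... | no _  | yes _ rewrite ex | ey = refl
  ... | no _  | no _  rewrite ex | ey = quant-cong (subst-comm x≢y A)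

  -- Permits recursion on a formula with every substitution instance of the
  -- body of a quantifier counted as smaller.

  data Recursive : Form S → Set where
    atom  : ∀ {n} {P : Predicate S n} {ts} → Recursive (atom P ts)
    un    : ∀ {u A} → Recursive A → Recursive (un u A)
    bin   : ∀ {b A B} → Recursive A → Recursive B → Recursive (bin b A B)
    quant : ∀ {Q x A} .{p : Free x A} →
            (∀ c → Recursive (A [ cst c / x ])) → Recursive (quant Q x A p)

  -- If the bound variable is `x`, nothing is replaced. Otherwise, by `subst-comm`, the instance of
  -- the body can be formed first, and the recursion is on the witness `r d` for that instance.
  recursive-subst : ∀ {A x c} → Recursive A → Recursive (A [ cst c / x ])
  recursive-subst atom      = atom
  recursive-subst (un r)    = un (recursive-subst r)
  recursive-subst (bin r s) = bin (recursive-subst r) (recursive-subst s)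
  recursive-subst {quant Q y A p} {x} (quant r) with x ≟ y
  ... | yes _   = quant r
  ... | no  x≢y = quant λ d →
    subst Recursive (sym (subst-comm x≢y A)) (recursive-subst (r d))

  recursive : ∀ A → Recursive A
  recursive (atom P ts)     = atom
  recursive (un u A)        = un (recursive A)
  recursive (bin b A B)     = bin (recursive A) (recursive B)
  recursive (quant Q x A p) = quant λ c → recursive-subst (recursive A)

  un₁ : ∀ {x} → Unary → Form₁ S x → Form₁ S x
  un₁ u A = mkForm₁ (un u (form₁ A)) (only A)

-- Replacement of constants with the same denotation

module _ {S : Signature} (M : Interpretation S) where

  private
    𝔄  = structure M
    S⁺ = diagram 𝔄
    v  = valuation M

  open Structure 𝔄 using (Domain; identity⁺)
  open Structure (expansion 𝔄) using (⟦_⟧ᶜ)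
  open IsValuation (isValuation M)

  ∀-cong : ∀ {x} (A B : Form₁ S⁺ x) .{p : Free x (form₁ A)} .{q : Free x (form₁ B)} →
           (∀ a → v (A ⟨ name a ⟩) ≡ v (B ⟨ name a ⟩)) → v (∀ˢ A p) ≡ v (∀ˢ B q)
  ∀-cong A B {p} {q} e = ⇔→≡ (mk⇔
    (λ h → from (v-∀ B q) λ a → trans (sym (e a)) (to (v-∀ A p) h a))
    (λ h → from (v-∀ A p) λ a → trans (e a) (to (v-∀ B q) h a)))

  ∃-cong : ∀ {x} (A B : Form₁ S⁺ x) .{p : Free x (form₁ A)} .{q : Free x (form₁ B)} →
           (∀ a → v (A ⟨ name a ⟩) ≡ v (B ⟨ name a ⟩)) → v (∃ˢ A p) ≡ v (∃ˢ B q)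
  ∃-cong A B {p} {q} e = ⇔→≡ (mk⇔
    (λ h → let (a , t) = to (v-∃ A p) h in from (v-∃ B q) (a , trans (sym (e a)) t))
    (λ h → let (a , t) = to (v-∃ B q) h in from (v-∃ A p) (a , trans (e a) t)))

  quantˢ-cong : ∀ {x} Q (A B : Form₁ S⁺ x) .{p : Free x (form₁ A)} .{q : Free x (form₁ B)} →
                (∀ a → v (A ⟨ name a ⟩) ≡ v (B ⟨ name a ⟩)) →
                v (quantˢ Q A p) ≡ v (quantˢ Q B q)
  quantˢ-cong univ = ∀-cong
  quantˢ-cong exis = ∃-cong

  binˢ-cong : ∀ b {A A′ B B′} → v A ≡ v A′ → v B ≡ v B′ →
              v (binˢ b A B) ≡ v (binˢ b A′ B′)
  binˢ-cong conj {A} {A′} {B} {B′} e f = ⇔→≡ (mk⇔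
    (λ h → let (s , t) = to (v-∧ A B) h in
           from (v-∧ A′ B′) (trans (sym e) s , trans (sym f) t))
    (λ h → let (s , t) = to (v-∧ A′ B′) h in
           from (v-∧ A B) (trans e s , trans f t)))
  binˢ-cong disj {A} {A′} {B} {B′} e f = ⇔→≡ (mk⇔
    (from (v-∨ A′ B′) ∘ Sum.map (trans (sym e)) (trans (sym f)) ∘ to (v-∨ A B))
    (from (v-∨ A B) ∘ Sum.map (trans e) (trans f) ∘ to (v-∨ A′ B′)))

  module _ {x : ℕ} {c₁ c₂ : Constant S⁺} (c₁≡c₂ : ⟦ c₁ ⟧ᶜ ≡ ⟦ c₂ ⟧ᶜ) where

    -- Since only `x` may be free in `t`, both results are constants. This brings atomic instances
    -- into the shape `atomˢ P ds`, to which `v-atom` applies.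
    substT-closed : ∀ t → (∀ y → y ≢ x → ¬ FreeT y t) →
      ∃[ d₁ ] ∃[ d₂ ] substT {S⁺} (cst c₁) x t ≡ cst d₁ × substT (cst c₂) x t ≡ cst d₂ ×
                      ⟦ d₁ ⟧ᶜ ≡ ⟦ d₂ ⟧ᶜ
    substT-closed (cst d) o = d , d , refl , refl , refl
    substT-closed (var y) o with x ≟ y
    ... | yes _  = c₁ , c₂ , refl , refl , c₁≡c₂
    ... | no x≢y = ⊥-elim (o y (x≢y ∘ sym) refl)

    substV-closed : ∀ {n} (ts : Vec (Term S⁺) n) → (∀ y → y ≢ x → ¬ Any (FreeT y) ts) →
      ∃[ ds₁ ] ∃[ ds₂ ] Vec.map (substT (cst c₁) x) ts ≡ Vec.map cst ds₁ ×
                        Vec.map (substT (cst c₂) x) ts ≡ Vec.map cst ds₂ ×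
                        Vec.map ⟦_⟧ᶜ ds₁ ≡ Vec.map ⟦_⟧ᶜ ds₂
    substV-closed []       o = [] , [] , refl , refl , refl
    substV-closed (t ∷ ts) o =
      let (d₁  , d₂  , e₁ , e₂ , e) = substT-closed t (λ y y≢x → o y y≢x ∘ here)
          (ds₁ , ds₂ , f₁ , f₂ , f) = substV-closed ts (λ y y≢x → o y y≢x ∘ there)
      in d₁ ∷ ds₁ , d₂ ∷ ds₂ , cong₂ _∷_ e₁ f₁ , cong₂ _∷_ e₂ f₂ , cong₂ _∷_ e f

    -- Atoms depend only on denotations, the unary case is the valuation clause `v-subst`, and the
    -- binary and quantifier cases follow from their truth clauses. The quantifier case recurses on
    -- instances of the body, which are not subformulas, hence the argument `Recursive`.
    replacement-rec : (A : Form₁ S⁺ x) → Recursive (form₁ A) → v (A ⟨ c₁ ⟩) ≡ v (A ⟨ c₂ ⟩)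
    replacement-rec (mkForm₁ (atom P ts) o) atom =
      let (ds₁ , ds₂ , e₁ , e₂ , e) = substV-closed ts o
          P⁺ = Structure._⁺ 𝔄 P
      in trans (cong v (sent-≡ {B = atomˢ P ds₁} (cong (atom P) e₁)))
        (trans (⇔→≡ (mk⇔
                 (from (v-atom P ds₂) ∘ subst P⁺ e ∘ to (v-atom P ds₁))
                 (from (v-atom P ds₁) ∘ subst P⁺ (sym e) ∘ to (v-atom P ds₂))))
               (cong v (sent-≡ {A = atomˢ P ds₂} (cong (atom P) (sym e₂)))))
    replacement-rec (mkForm₁ (un u A) o) (un r) =
      v-subst (mkForm₁ A o) c₁ c₂ c₁≡c₂ (replacement-rec (mkForm₁ A o) r) u
    replacement-rec (mkForm₁ (bin b A B) o) (bin r s) =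
      binˢ-cong b (replacement-rec (mkForm₁ A (λ y y≢x → o y y≢x ∘ inj₁)) r)
                  (replacement-rec (mkForm₁ B (λ y y≢x → o y y≢x ∘ inj₂)) s)
    replacement-rec (mkForm₁ (quant Q y A p) o) (quant r) = case x ≟ y of λ where
        (yes x≡y) → cong v (sent-≡ (trans (subst-bound x≡y) (sym (subst-bound x≡y))))
        (no  x≢y) →
          trans (cong v (sent-≡ (subst-under x≢y)))
         (trans (quantˢ-cong Q (A₁ c₁) (A₁ c₂) λ a →
                  -- Substituting the name of `a` before `c₁` or `c₂` leaves a formula in which only
                  -- `x` may be free, and `r (name a)` covers it.
                  trans (cong v (sent-≡ (subst-comm x≢y A)))
                 (trans (replacement-rec (A₂ a) (r (name a)))
                        (cong v (sent-≡ (sym (subst-comm x≢y A))))))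
                (cong v (sent-≡ (sym (subst-under x≢y)))))
      where
      A₁ : Constant S⁺ → Form₁ S⁺ y
      A₁ c = mkForm₁ (A [ cst c / x ]) λ z z≢y f →
        let (z≢x , g) = free-subst⁻¹ A f in o z z≢x (z≢y , g)
      A₂ : Domain → Form₁ S⁺ x
      A₂ a = mkForm₁ (A [ cst (name a) / y ]) λ z z≢x f → o z z≢x (free-subst⁻¹ A f)

    replacement : (A : Form₁ S⁺ x) → v (A ⟨ c₁ ⟩) ≡ v (A ⟨ c₂ ⟩)
    replacement A = replacement-rec A (recursive (form₁ A))

  -- Relational assignments of diagram constants

  record Assignment : Set₁ where
    field
      _↦_        : Constant S → Constant S⁺ → Set
      functional : ∀ {c d e} → c ↦ d → c ↦ e → d ≡ e
      total      : ∀ c → ¬ ¬ (∃[ d ] c ↦ d)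

  open Assignment

  inclusion : Assignment
  inclusion = record
    { _↦_        = λ c d → inj₁ c ≡ d
    ; functional = λ e f → trans (sym e) f
    ; total      = λ c k → k (inj₁ c , refl)
    }

  update : Assignment → Constant S → Domain → Assignment
  update α c a ._↦_ e f = (e ≡ c × f ≡ name a) ⊎ (e ≢ c × (α ↦ e) f)
  update α c a .functional (inj₁ (_ , p))  (inj₁ (_ , q))  = trans p (sym q)
  update α c a .functional (inj₁ (p , _))  (inj₂ (¬p , _)) = contradiction p ¬p
  update α c a .functional (inj₂ (¬p , _)) (inj₁ (p , _))  = contradiction p ¬p
  update α c a .functional (inj₂ (_ , p))  (inj₂ (_ , q))  = functional α p q
  -- The goal is absurdity, so a case distinction on `e ≡ c` is available here.
  update α c a .total e k = ¬¬-excluded-middle λ where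
    (yes e≡c) → k (name a , inj₁ (e≡c , refl))
    (no e≢c)  → total α e λ (d , r) → k (d , inj₂ (e≢c , r))

  -- Instances of formulas under an assignment

  data InstanceT (α : Assignment) : Term S → Term S⁺ → Set where
    var : ∀ {x} → InstanceT α (var x) (var x)
    cst : ∀ {c d} → (α ↦ c) d → InstanceT α (cst c) (cst d)

  -- The graph of simultaneous replacement of constants: as `α` is only a relation, the result
  -- cannot be computed from the formula.
  data Instance (α : Assignment) : Form S → Form S⁺ → Set where
    atom  : ∀ {n} {P : Predicate S n} {ts us} → Pointwise (InstanceT α) ts us →
            Instance α (atom P ts) (atom P us)
    un    : ∀ {u A A′} → Instance α A A′ → Instance α (un u A) (un u A′)
    bin   : ∀ {b A A′ B B′} → Instance α A A′ → Instance α B B′ →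
            Instance α (bin b A B) (bin b A′ B′)
    quant : ∀ {Q x A A′} .{p : Free x A} .{q : Free x A′} → Instance α A A′ →
            Instance α (quant Q x A p) (quant Q x A′ q)

  instanceV-free : ∀ {α y n} {ts : Vec (Term S) n} {us : Vec (Term S⁺) n} → Pointwise (InstanceT α) ts us →
                   Any (FreeT {S} y) ts → Any (FreeT {S⁺} y) us
  instanceV-free (var ∷ is) (here p)  = here p
  instanceV-free (i ∷ is)   (there p) = there (instanceV-free is p)

  instanceV-free⁻¹ : ∀ {α y n} {ts : Vec (Term S) n} {us : Vec (Term S⁺) n} → Pointwise (InstanceT α) ts us →
                     Any (FreeT {S⁺} y) us → Any (FreeT {S} y) ts
  instanceV-free⁻¹ (var ∷ is) (here p)  = here p
  instanceV-free⁻¹ (i ∷ is)   (there p) = there (instanceV-free⁻¹ is p)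

  -- This direction yields the non-voidness proofs of quantified instances; the converse below makes
  -- instances of sentences closed.
  instance-free : ∀ {α y A F} → Instance α A F → Free y A → Free y F
  instance-free (atom is)  p         = instanceV-free is p
  instance-free (un i)     p         = instance-free i p
  instance-free (bin i j)  p         = Sum.map (instance-free i) (instance-free j) p
  instance-free (quant i)  (y≢x , p) = y≢x , instance-free i p

  instance-free⁻¹ : ∀ {α y A F} → Instance α A F → Free y F → Free y A
  instance-free⁻¹ (atom is)  p         = instanceV-free⁻¹ is p
  instance-free⁻¹ (un i)     p         = instance-free⁻¹ i p
  instance-free⁻¹ (bin i j)  p         = Sum.map (instance-free⁻¹ i) (instance-free⁻¹ j) p
  instance-free⁻¹ (quant i)  (y≢x , p) = y≢x , instance-free⁻¹ i p

  instanceˢ : ∀ {α F} A → Instance α (form A) F → Sent S⁺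
  instanceˢ {F = F} A i = mkSent F λ y p → closed A y (instance-free⁻¹ i p)

  instance₁ : ∀ {α x F} (A : Form₁ S x) → Instance α (form₁ A) F → Form₁ S⁺ x
  instance₁ {F = F} A i = mkForm₁ F λ y y≢x p → only A y y≢x (instance-free⁻¹ i p)

  instanceT-exists : ∀ α t → ¬ ¬ (∃[ u ] InstanceT α t u)
  instanceT-exists α (var x) k = k (var x , var)
  instanceT-exists α (cst c) k = total α c λ (d , r) → k (cst d , cst r)

  instanceV-exists : ∀ α {n} (ts : Vec (Term S) n) → ¬ ¬ (∃[ us ] Pointwise (InstanceT α) {n} {n} ts us)
  instanceV-exists α []       k = k ([] , [])
  instanceV-exists α (t ∷ ts) k =
    instanceT-exists α t λ (u , i) →
    instanceV-exists α ts λ (us , is) → k (u ∷ us , i ∷ is)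

  -- A formula contains finitely many constants, so the double negations coming from `total` can be
  -- chained.
  instance-exists : ∀ α A → ¬ ¬ (∃[ F ] Instance α A F)
  instance-exists α (atom P ts) k =
    instanceV-exists α ts λ (us , is) → k (atom P us , atom is)
  instance-exists α (un u A) k =
    instance-exists α A λ (F , i) → k (un u F , un i)
  instance-exists α (bin b A B) k =
    instance-exists α A λ (F , i) →
    instance-exists α B λ (G , j) → k (bin b F G , bin i j)
  instance-exists α (quant Q x A p) k =
    instance-exists α A λ (F , i) → k (quant Q x F (instance-free i p) , quant i)

  instanceT-unique : ∀ {α t u u′} → InstanceT α t u → InstanceT α t u′ → u ≡ u′
  instanceT-unique     var     var     = refl
  instanceT-unique {α} (cst r) (cst s) = cong cst (functional α r s)

  instanceV-unique : ∀ {α n} {ts : Vec (Term S) n} {us us′ : Vec (Term S⁺) n} → Pointwise (InstanceT α) ts us →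
                     Pointwise (InstanceT α) ts us′ → us ≡ us′
  instanceV-unique []       []       = refl
  instanceV-unique (i ∷ is) (j ∷ js) = cong₂ _∷_ (instanceT-unique i j) (instanceV-unique is js)

  instance-unique : ∀ {α A F G} → Instance α A F → Instance α A G → F ≡ G
  instance-unique (atom is)  (atom js)    = cong (atom _) (instanceV-unique is js)
  instance-unique (un i)     (un j)       = cong (un _) (instance-unique i j)
  instance-unique (bin i i′) (bin j j′)   = cong₂ (bin _) (instance-unique i j) (instance-unique i′ j′)
  instance-unique (quant i)  (quant j)    = quant-cong (instance-unique i j)

  instanceT-mono : ∀ {α β t u} → (∀ {c d} → OccursT {S} c t → (α ↦ c) d → (β ↦ c) d) →
                   InstanceT α t u → InstanceT β t u
  instanceT-mono f var     = var
  instanceT-mono f (cst r) = cst (f refl r)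

  instanceV-mono : ∀ {α β n} {ts : Vec (Term S) n} {us : Vec (Term S⁺) n} →
                   (∀ {c d} → Any (OccursT {S} c) ts → (α ↦ c) d → (β ↦ c) d) →
                   Pointwise (InstanceT α) ts us → Pointwise (InstanceT β) ts us
  instanceV-mono f []       = []
  instanceV-mono f (i ∷ is) = instanceT-mono (f ∘ here) i ∷ instanceV-mono (f ∘ there) is

  -- Only the constants occurring in `A` matter. Hence updating at a constant foreign to `A` changes
  -- none of its instances, in either direction.
  instance-mono : ∀ {α β A F} → (∀ {c d} → Occurs c A → (α ↦ c) d → (β ↦ c) d) →
                  Instance α A F → Instance β A F
  instance-mono f (atom is)  = atom (instanceV-mono f is)
  instance-mono f (un i)     = un (instance-mono f i)
  instance-mono f (bin i j)  = bin (instance-mono (f ∘ inj₁) i) (instance-mono (f ∘ inj₂) j)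
  instance-mono f (quant i)  = quant (instance-mono f i)

  instance-update : ∀ {α c a A F} → c ∉ᶜ A → Instance α A F → Instance (update α c a) A F
  instance-update c∉A = instance-mono λ { o r → inj₂ ((λ { refl → c∉A o }) , r) }

  instance-update⁻¹ : ∀ {α c a A F} → c ∉ᶜ A → Instance (update α c a) A F → Instance α A F
  instance-update⁻¹ c∉A = instance-mono λ where
    o (inj₁ (refl , _)) → contradiction o c∉A
    o (inj₂ (_ , r))    → r

  instanceT-subst : ∀ {α x c d t u} → (α ↦ c) d → InstanceT α t u →
                    InstanceT α (substT (cst c) x t) (substT (cst d) x u)
  instanceT-subst         r (cst s)   = cst s
  instanceT-subst {x = x} r (var {y}) with x ≟ y
  ... | yes _ = cst r
  ... | no  _ = var

  instanceV-subst : ∀ {α x c d n} {ts : Vec (Term S) n} {us : Vec (Term S⁺) n} → (α ↦ c) d →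
                    Pointwise (InstanceT α) ts us →
                    Pointwise (InstanceT α) (Vec.map (substT (cst c) x) ts)
                                            (Vec.map (substT (cst d) x) us)
  instanceV-subst r []       = []
  instanceV-subst r (i ∷ is) = instanceT-subst r i ∷ instanceV-subst r is

  -- Under `update α c a`, which relates `c` to `name a`, this makes `F [ cst (name a) / x ]` an
  -- instance of `A [ cst c / x ]`, as the eigenconstant rules require.
  instance-subst : ∀ {α x c d A F} → (α ↦ c) d → Instance α A F →
                   Instance α (A [ cst c / x ]) (F [ cst d / x ])
  instance-subst r (atom is) = atom (instanceV-subst r is)
  instance-subst r (un i)    = un (instance-subst r i)
  instance-subst r (bin i j) = bin (instance-subst r i) (instance-subst r j)
  instance-subst {x = x} r (quant {x = y} i) with x ≟ y
  ... | yes _ = quant i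
  ... | no  _ = quant (instance-subst r i)

  matchT-instance : ∀ {α ρ t u t′ u′} → MatchT ρ t u →
                    InstanceT α t t′ → InstanceT α u u′ → MatchT ρ t′ u′
  matchT-instance     (var m) var     var     = var m
  matchT-instance {α} cst     (cst r) (cst s) with functional α r s
  ... | refl = cst

  matchV-instance : ∀ {α ρ n} {ts us : Vec (Term S) n} {ts′ us′ : Vec (Term S⁺) n} → Pointwise (MatchT ρ) ts us →
                    Pointwise (InstanceT α) ts ts′ → Pointwise (InstanceT α) us us′ →
                    Pointwise (MatchT ρ) ts′ us′
  matchV-instance []       []       []       = []
  matchV-instance (m ∷ ms) (i ∷ is) (j ∷ js) = matchT-instance m i j ∷ matchV-instance ms is js

  -- Replacement leaves variables alone, so the pairing `ρ` carries over; equal constants get equal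
  -- values because `α` is functional.
  variant-instance : ∀ {α ρ A B F G} → Variant ρ A B →
                     Instance α A F → Instance α B G → Variant ρ F G
  variant-instance (atom ms) (atom is)  (atom js)  = atom (matchV-instance ms is js)
  variant-instance (un w)    (un i)     (un j)     = un (variant-instance w i j)
  variant-instance (bin w z) (bin i i′) (bin j j′) = bin (variant-instance w i j) (variant-instance z i′ j′)
  variant-instance (quant w) (quant i)  (quant j)  = quant (variant-instance w i j)

  instanceV-embed : ∀ {n} (ts : Vec (Term S) n) →
                    Pointwise (InstanceT inclusion) ts (Vec.map (embedT 𝔄) ts)
  instanceV-embed []           = []
  instanceV-embed (var x ∷ ts) = var ∷ instanceV-embed ts
  instanceV-embed (cst c ∷ ts) = cst refl ∷ instanceV-embed ts

  instance-embed : ∀ A → Instance inclusion A (embedF 𝔄 A)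
  instance-embed (atom P ts)     = atom (instanceV-embed ts)
  instance-embed (un u A)        = un (instance-embed A)
  instance-embed (bin b A B)     = bin (instance-embed A) (instance-embed B)
  instance-embed (quant Q x A p) = quant (instance-embed A)

  -- Truth under an assignment and soundness of the rules

  Holds : Assignment → Sent S → Set
  Holds α A = ∀ {F} (i : Instance α (form A) F) → True (instanceˢ A i)

  Holds* : Assignment → Pred (Sent S) 0ℓ → Set
  Holds* α H = ∀ B → B ∈ H → Holds α B

  holds : ∀ {α F} A (i : Instance α (form A) F) → True (instanceˢ A i) → Holds α A
  holds A i t j = trans (cong v (sent-≡ (instance-unique j i))) t

  -- Equality of Booleans is decidable, hence stable under double negation, so an instance of `A`
  -- may be assumed to be at hand.
  choose : ∀ α A {b} → (∀ {F} → Instance α A F → b ≡ true) → b ≡ true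
  choose α A k = decidable-stable (_ ≟ᵇ true) λ ¬t →
    instance-exists α A λ (F , i) → ¬t (k i)

  chooseᶜ : ∀ α c {b} → (∀ {d} → (α ↦ c) d → b ≡ true) → b ≡ true
  chooseᶜ α c k = decidable-stable (_ ≟ᵇ true) λ ¬t →
    total α c λ (d , r) → ¬t (k r)

  -- Whether `B` is the discharged `A` is undecidable. But if `B` failed, it would differ from `A`,
  -- which holds, and so would lie in `H ∖ ｛ A ｝`, whose members hold.
  discharge : ∀ {α H A} → Holds α A → Holds* α (H ∖ ｛ A ｝) → Holds* α H
  discharge hA h B B∈H i = decidable-stable (_ ≟ᵇ true) λ ¬t →
    ¬t (h B (B∈H , λ { refl → ¬t (hA i) }) i)

  holds-update : ∀ {α c a H} → c freshFor H → Holds* α H → Holds* (update α c a) H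
  holds-update fr h B B∈H i = h B B∈H (instance-update⁻¹ (fr B B∈H) i)

  clash : ∀ {b} {X : Set} → b ≡ true → b ≡ false → X
  clash refl ()

  -- Induction on the derivation, with `α` general because the eigenconstant rules use the induction
  -- hypothesis at `update α c a`. Formulas absent from the conclusion get their instances from
  -- `choose`.
  sound : ∀ {H A} → H ▷ A → ∀ α → Holds* α H → Holds α A
  sound (hyp A) α h i = h A refl i
  sound (∧I d e) α h (bin i j) =
    from (v-∧ _ _) (sound d α (λ B → h B ∘ inj₁) i , sound e α (λ B → h B ∘ inj₂) j)
  sound (∧E₁ {B = B} d) α h i =
    choose α (form B) λ j → proj₁ (to (v-∧ _ (instanceˢ B j)) (sound d α h (bin i j)))
  sound (∧E₂ {A = A} d) α h j =
    choose α (form A) λ i → proj₂ (to (v-∧ (instanceˢ A i) _) (sound d α h (bin i j)))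
  sound (∨I₁ {B = B} d) α h (bin i j) = from (v-∨ _ (instanceˢ B j)) (inj₁ (sound d α h i))
  sound (∨I₂ {A = A} d) α h (bin i j) = from (v-∨ (instanceˢ A i) _) (inj₂ (sound d α h j))
  sound (∨E {A = A} {B} d e f) α h k =
    choose α (form A) λ i → choose α (form B) λ j →
      [ (λ t → sound e α (discharge (holds A i t) (λ D → h D ∘ inj₂ ∘ inj₁)) k)
      , (λ t → sound f α (discharge (holds B j t) (λ D → h D ∘ inj₂ ∘ inj₂)) k)
      ]′ (to (v-∨ (instanceˢ A i) (instanceˢ B j)) (sound d α (λ D → h D ∘ inj₁) (bin i j)))
  sound (¬∧I₁ {B = B} d) α h (un (bin i j)) = from (v-¬∧ _ (instanceˢ B j)) (inj₁ (sound d α h (un i)))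
  sound (¬∧I₂ {A = A} d) α h (un (bin i j)) = from (v-¬∧ (instanceˢ A i) _) (inj₂ (sound d α h (un j)))
  sound (¬∧E {A = A} {B} d e f) α h k =
    choose α (form A) λ i → choose α (form B) λ j →
      [ (λ t → sound e α (discharge (holds (¬ˢ A) (un i) t) (λ D → h D ∘ inj₂ ∘ inj₁)) k)
      , (λ t → sound f α (discharge (holds (¬ˢ B) (un j) t) (λ D → h D ∘ inj₂ ∘ inj₂)) k)
      ]′ (to (v-¬∧ (instanceˢ A i) (instanceˢ B j)) (sound d α (λ D → h D ∘ inj₁) (un (bin i j))))
  sound (¬∨I d e) α h (un (bin i j)) =
    from (v-¬∨ _ _) (sound d α (λ B → h B ∘ inj₁) (un i) , sound e α (λ B → h B ∘ inj₂) (un j))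
  sound (¬∨E₁ {B = B} d) α h (un i) =
    choose α (form B) λ j → proj₁ (to (v-¬∨ _ (instanceˢ B j)) (sound d α h (un (bin i j))))
  sound (¬∨E₂ {A = A} d) α h (un j) =
    choose α (form A) λ i → proj₂ (to (v-¬∨ (instanceˢ A i) _) (sound d α h (un (bin i j))))
  sound (DNI d) α h (un (un i)) = from (v-¬¬ _) (sound d α h i)
  sound (DNE d) α h i = to (v-¬¬ _) (sound d α h (un (un i)))
  sound (EXP∘ {A = A} d e f) α h k = choose α (form A) λ i →
    clash (sound f α (λ B → h B ∘ inj₂ ∘ inj₂) (un i))
          (to (v-∘ _ (sound d α (λ B → h B ∘ inj₁) (un i)))
              (sound e α (λ B → h B ∘ inj₂ ∘ inj₁) i))
  -- The two occurrences of `A` come with separate instances, which uniqueness identifies. The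
  -- Boolean value of the negation then decides the disjunct.
  sound (PEM∘ {A = A} d) α h (bin i (un j)) with instance-unique i j
  ... | refl = pem _ refl
    where
    pem : ∀ b → v (¬ˢ instanceˢ A i) ≡ b → True (instanceˢ A i ∨ˢ (¬ˢ instanceˢ A i))
    pem true  t = from (v-∨ (instanceˢ A i) _) (inj₂ t)
    pem false f = from (v-∨ _ (¬ˢ instanceˢ A i)) (inj₁ (from (v-∘ _ (sound d α h (un i))) f))
  sound (Cons {A = A} d e) α h k = choose α (form A) λ i →
    clash (sound e α (λ B → h B ∘ inj₂) (un i))
          (to (v-• _) (sound d α (λ B → h B ∘ inj₁) (un i)))
  sound (Comp {A = A}) α h (bin (un i) (un j)) with instance-unique i j
  ... | refl = comp _ refl
    where
    comp : ∀ b → v (•ˢ instanceˢ A i) ≡ b → True ((∘ˢ instanceˢ A i) ∨ˢ (•ˢ instanceˢ A i))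
    comp true  t = from (v-∨ (∘ˢ instanceˢ A i) _) (inj₂ t)
    comp false f = from (v-∨ _ (•ˢ instanceˢ A i)) (inj₁ (from (v-• _) f))
  sound (∀I {B = B} {c = c} {A} c∉A c∉B fr d) α h (bin i (quant {q = q} j)) = by-cases _ refl
    where
    A′ = instance₁ A j
    by-cases : ∀ b → v (instanceˢ B i) ≡ b → True (instanceˢ B i ∨ˢ ∀ˢ A′ q)
    by-cases true  t = from (v-∨ _ (∀ˢ A′ q)) (inj₁ t)
    -- With `B` false, the premise read with `c` as the name of `a` must hold through its second
    -- disjunct, for every `a`.
    by-cases false f = from (v-∨ (instanceˢ B i) _) (inj₂ (from (v-∀ A′ q) λ a →
      fromInj₂ (λ t → clash t f) (to (v-∨ (instanceˢ B i) (A′ ⟨ name a ⟩))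
        (sound d (update α c a) (holds-update fr h)
          (bin (instance-update c∉B i)
               (instance-subst (inj₁ (refl , refl)) (instance-update c∉A j)))))))
  sound (∀E {c = c} {A} {p} d) α h k =
    choose α (form₁ A) λ j → chooseᶜ α c λ {e} r →
      holds (A ⟨ c ⟩) (instance-subst r j)
        -- The clause for `∀` speaks only of names of domain elements. The constant `e` and the name
        -- of `⟦ e ⟧ᶜ` denote the same element by computation, so replacement by `refl` bridges the
        -- gap.
        (trans (replacement refl (instance₁ A j))
               (to (v-∀ (instance₁ A j) (instance-free j p)) (sound d α h (quant j)) ⟦ e ⟧ᶜ)) k
  sound (∃I {c = c} {A} d) α h (quant {q = q} j) = chooseᶜ α c λ {e} r →
    from (v-∃ (instance₁ A j) q)
      (⟦ e ⟧ᶜ , trans (replacement refl (instance₁ A j)) (sound d α h (instance-subst r j)))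
  sound (∃E {c = c} {A} {p} c∉A c∉C fr d e) α h k = choose α (form₁ A) λ j →
    let (a , t) = to (v-∃ (instance₁ A j) (instance-free j p))
                     (sound d α (λ B → h B ∘ inj₁) (quant j))
    -- The eigenconstant is reinterpreted as the name of the witness `a`; freshness protects the
    -- remaining hypotheses and `C`.
    in sound e (update α c a)
         (discharge
           (holds (A ⟨ c ⟩) (instance-subst (inj₁ (refl , refl)) (instance-update c∉A j)) t)
           (holds-update fr (λ B → h B ∘ inj₂)))
         (instance-update c∉C k)
  sound (¬∀I {c = c} {A} d) α h (un (quant {q = q} j)) = chooseᶜ α c λ {e} r →
    from (v-¬∀ (instance₁ A j) q)
      -- Replacement is applied to the negated body, itself a formula with at most `x` free.
      (⟦ e ⟧ᶜ , trans (replacement refl (un₁ neg (instance₁ A j)))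
                      (sound d α h (un (instance-subst r j))))
  sound (¬∀E {c = c} {A} {p} c∉A c∉C fr d e) α h k = choose α (form₁ A) λ j →
    let (a , t) = to (v-¬∀ (instance₁ A j) (instance-free j p))
                     (sound d α (λ B → h B ∘ inj₁) (un (quant j)))
    in sound e (update α c a)
         (discharge
           (holds (¬ˢ (A ⟨ c ⟩))
             (un (instance-subst (inj₁ (refl , refl)) (instance-update c∉A j))) t)
           (holds-update fr (λ B → h B ∘ inj₂)))
         (instance-update c∉C k)
  sound (¬∃I {c = c} {A} c∉A fr d) α h (un (quant {q = q} j)) =
    from (v-¬∃ (instance₁ A j) q) λ a →
      sound d (update α c a) (holds-update fr h)
        (un (instance-subst (inj₁ (refl , refl)) (instance-update c∉A j)))
  sound (¬∃E {c = c} {A} {p} d) α h k =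
    choose α (form₁ A) λ j → chooseᶜ α c λ {e} r →
      holds (¬ˢ (A ⟨ c ⟩)) (un (instance-subst r j))
        (trans (replacement refl (un₁ neg (instance₁ A j)))
               (to (v-¬∃ (instance₁ A j) (instance-free j p))
                   (sound d α h (un (quant j))) ⟦ e ⟧ᶜ)) k
  sound (≈I {c}) α h k = chooseᶜ α c λ r →
    holds (c ≈ˢ c) (atom (cst r ∷ cst r ∷ []))
      (from (v-atom (identity S) (_ ∷ _ ∷ [])) (from (identity⁺ _ _) refl)) k
  sound (≈E {c₁ = c₁} {c₂} {A} d e) α h k =
    choose α (form₁ A) λ j → chooseᶜ α c₁ λ r → chooseᶜ α c₂ λ s →
      holds (A ⟨ c₂ ⟩) (instance-subst s j)
        (trans (sym (replacement
                 -- The first premise, read through `v-atom` and `identity⁺`, says that the two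
                 -- chosen constants have the same denotation.
                 (to (identity⁺ _ _) (to (v-atom (identity S) (_ ∷ _ ∷ []))
                   (sound d α (λ B → h B ∘ inj₁) (atom (cst r ∷ cst s ∷ [])))))
                 (instance₁ A j)))
               (sound e α (λ B → h B ∘ inj₂) (instance-subst r j))) k
  sound (AV {A = A} w d) α h k = choose α (form A) λ i →
    trans (v-∼ (instanceˢ A i) _ (variant-instance w i k)) (sound d α h i)

theorem12 : (S : Signature) (Γ : Pred (Sent S) 0ℓ) (A : Sent S) → Γ ⊢ A → Γ ⊨ A
theorem12 S Γ A (H , H⊆Γ , d) M M⊩Γ =
  -- The embedding of a sentence is its instance under `inclusion`, so truth there is satisfaction
  -- in `M`.
  sound M d (inclusion M)
    (λ B B∈H → holds M B (instance-embed M (form B)) (M⊩Γ B (H⊆Γ B∈H)))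
    (instance-embed M (form A))
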